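{- Let $P_1(n)$ be the number of payphone permutations of type (P1) and size $n$. Then for any integer $n\geq 1$, $$P_1(n) = \sum_{i=1}^n G\big(S'(i-1)\cup S'(n-i)\big).$$
   Context: Multisets: $\#_k M$ denotes the multiplicity of $k$ in the multiset $M$, and $\cup$ denotes union of multisets with multiplicities added. For $n\ge 0$, the finite multiset $S(n)$ of positive integers is defined recursively by $S(0)=\emptyset$ and $$S(n)=\{n\}\cup S\left(\left\lfloor\tfrac{n-1}{2}\right\rfloor\right)\cup S\left(\left\lceil\tfrac{n-1}{2}\right\rceil\right)\quad (n\ge 1).$$ Further, $S'(0):=\emptyset$ and $S'(\ell):=S(\ell-1)\cup\{2\ell-1\}$ for $\ell\ge 1$. The function $G$ is defined on the finite multisets $M$ of positive integers by $$G(M) := \bigg(\prod_{k\geq 1} (\#_{2k} M + \#_{2k-1} M)!\bigg) \cdot 2^{\sum_{k\geq 2} \#_{2k} M}.$$ Type (P1) payphone permutations: $n$ payphones, labeled $1,\dots,n$, are arranged in a row; the distance between payphones $i$ and $j$ is $|i-j|$. Persons $1,2,\dots,n$ come one after another and each occupies an available payphone. The first person takes any payphone. Each subsequent person obeys rule (P1): the person takes any available payphone such that its closest occupied payphone is as distant as possible (i.e., among all available payphones, one maximizing the distance to the set of occupied payphones). The resulting assignment of people to payphones, $(p_1,\dots,p_n)$ with $p_j$ the person occupying payphone $j$, is a payphone permutation of type (P1) and size $n$; $P_1(n)$ counts the distinct permutations of $\{1,\dots,n\}$ that can arise this way. -}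

module Defs where

open import Data.Fin.Base using (Fin; toℕ)
open import Data.Fin.Properties using (all?)
open import Data.List.Base
  using (List; []; _∷_; _++_; allFin; concatMap; deduplicate; filter; length; map; upTo)
open import Data.List.Extrema.Nat using (max; min)
open import Data.Maybe.Base using (Maybe; just; nothing)
import Data.Maybe.Properties as Maybe
open import Data.Nat.Base
open import Data.Nat.Induction using (Acc; acc; <-wellFounded)
open import Data.Nat.ListAction using (product; sum)
open import Data.Nat.Properties using (_≟_; _≤?_; ⌊n/2⌋≤n; ⌈n/2⌉≤n)
open import Data.Product.Base using (_×_)
open import Data.Vec.Base using (Vec; lookup; replicate; _[_]≔_)
import Data.Vec.Properties as Vec
open import Relation.Binary.PropositionalEquality using (_≡_; cong; cong₂; refl)
open import Relation.Nullary using (Dec; ¬?; _×-dec_; _→-dec_)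

-- [ a ⋯ b ] lists a, a+1, …, b in order; it is empty if b < a.
[_⋯_] : ℕ → ℕ → List ℕ
[ a ⋯ b ] = map (a +_) (upTo (suc b ∸ a))

-- Finite multisets are lists whose order is never inspected: _++_ is the
-- union with multiplicities added.
Multiset : Set
Multiset = List ℕ

#[_]_ : ℕ → Multiset → ℕ
#[ k ] M = length (filter (k ≟_) M)

S-acc : ∀ n → Acc _<_ n → Multiset
S-acc zero    _        = []
S-acc (suc m) (acc rs) =
  suc m ∷ S-acc ⌊ m /2⌋ (rs (s≤s (⌊n/2⌋≤n m))) ++ S-acc ⌈ m /2⌉ (rs (s≤s (⌈n/2⌉≤n m)))

S : ℕ → Multiset
S n = S-acc n (<-wellFounded n)

S-acc-irrelevant : ∀ n (p q : Acc _<_ n) → S-acc n p ≡ S-acc n q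
S-acc-irrelevant zero    _        _        = refl
S-acc-irrelevant (suc m) (acc rs) (acc ss) =
  cong (suc m ∷_) (cong₂ _++_ (S-acc-irrelevant ⌊ m /2⌋ (rs _) (ss _))
                              (S-acc-irrelevant ⌈ m /2⌉ (rs _) (ss _)))

S-suc : ∀ m → S (suc m) ≡ suc m ∷ S ⌊ m /2⌋ ++ S ⌈ m /2⌉
S-suc m = cong (suc m ∷_) (cong₂ _++_ (S-acc-irrelevant ⌊ m /2⌋ _ _) (S-acc-irrelevant ⌈ m /2⌉ _ _))

S′ : ℕ → Multiset
S′ zero      = []
S′ l@(suc m) = S m ++ (2 * l ∸ 1 ∷ [])

-- The product over k ≥ 1 and the sum over k ≥ 2 are cut off at the largest
-- element b of M: for k > b both 2k and 2k-1 exceed b, so the remaining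
-- factors are 0! and the remaining summands are 0.
G : Multiset → ℕ
G M = product (map (λ k → (#[ 2 * k ] M + #[ 2 * k ∸ 1 ] M) !) [ 1 ⋯ b ])
    * 2 ^ sum (map (λ k → #[ 2 * k ] M) [ 2 ⋯ b ])
  where b = max 0 M

-- Payphones are numbered from 0 and people from 1.  An entry  just p  is an
-- occupied payphone, with its person p; a row without  nothing  is the
-- assignment (p₁ , … , pₙ).
Row : ℕ → Set
Row n = Vec (Maybe ℕ) n

module _ {n : ℕ} where

  Available : Row n → Fin n → Set
  Available r j = lookup r j ≡ nothing

  available? : ∀ r j → Dec (Available r j)
  available? r j = Maybe.≡-dec _≟_ (lookup r j) nothing

  occupied : Row n → List (Fin n)
  occupied r = filter (λ i → ¬? (available? r i)) (allFin n)

  -- The default value n exceeds every distance in the row, so it never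
  -- affects the minimum once some payphone is occupied.
  distanceToOccupied : Row n → Fin n → ℕ
  distanceToOccupied r j = min n (map (λ i → ∣ toℕ i - toℕ j ∣) (occupied r))

  ObeysP1 : Row n → Fin n → Set
  ObeysP1 r j = Available r j
              × (∀ k → Available r k → distanceToOccupied r k ≤ distanceToOccupied r j)

  obeysP1? : ∀ r j → Dec (ObeysP1 r j)
  obeysP1? r j =
    available? r j
      ×-dec all? λ k → available? r k →-dec (distanceToOccupied r k ≤? distanceToOccupied r j)

-- All rows that can arise once persons 1, …, t have come, possibly with
-- repetitions.
rowsAfter : ∀ n → ℕ → List (Row n)
rowsAfter n 0             = replicate n nothing ∷ []
rowsAfter n 1             = map (λ j → replicate n nothing [ j ]≔ just 1) (allFin n)
rowsAfter n (suc t@(suc _)) =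
  concatMap (λ r → map (λ j → r [ j ]≔ just (suc t)) (filter (obeysP1? r) (allFin n)))
            (rowsAfter n t)

payphonePermutations : ∀ n → List (Row n)
payphonePermutations n = deduplicate (Vec.≡-dec (Maybe.≡-dec _≟_)) (rowsAfter n n)

P₁ : ℕ → ℕ
P₁ n = length (payphonePermutations n)

{-# OPTIONS --safe #-}

-- Once somebody has come, the available payphones form gaps, and the number of
-- completions of a row is G (M) for the union M of the multisets S (inner gaps)
-- and S′ (gaps at an end of the row) of its gap lengths.  For the induction on
-- the number of available payphones, let 2k or 2k-1 be the greatest element
-- of M.  Then k is the greatest distance, and taking a payphone at distance k
-- removes one element 2k or 2k-1 ("level k") from M.  Comparing the factors of
-- G shows that, multiplied by the number l of elements of M at level k, the
-- completions through the payphones at distance k of a given gap number G (M)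
-- times the number of elements at level k of that gap.  Summing over the gaps
-- and cancelling l gives G (M).
module Submission where

open import Defs
open import Data.Bool.Base using (Bool; true; false)
open import Data.Fin.Base using (Fin; zero; suc; toℕ)
import Data.Fin.Properties as Fin
open import Data.List.Base
  using (List; []; _∷_; _++_; allFin; applyUpTo; concatMap; deduplicate; filter; length; map;
         tabulate)
open import Data.List.Extrema.Nat using (max; max≤v⁺; min≈v⁺; xs≤max)
open import Data.List.Membership.Propositional using (_∈_)
open import Data.List.Membership.Propositional.Properties
  using (∈-allFin; ∈-filter⁺; ∈-map⁺; ∈-map∘filter⁻)
open import Data.List.Properties
  using (++-assoc; ++-identityʳ; filter-accept; filter-all; filter-reject; filter-some;
         filter-++; length-++; map-++; map-applyUpTo; map-cong; map-tabulate; map-upTo; map-∘;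
         tabulate-cong)
open import Data.List.Relation.Binary.Disjoint.Propositional using (Disjoint)
open import Data.List.Relation.Binary.Permutation.Propositional using (_↭_; ↭-reflexive; ↭-trans)
open import Data.List.Relation.Binary.Permutation.Propositional.Properties
  using (All-resp-↭; filter-↭; shift; ↭-length; ++-comm; ++⁺ʳ; ++⁺ˡ)
import Data.List.Relation.Unary.All as All
open import Data.List.Relation.Unary.All using (All; []; _∷_)
import Data.List.Relation.Unary.All.Properties as All
open import Data.List.Relation.Unary.AllPairs using (AllPairs; []; _∷_)
import Data.List.Relation.Unary.AllPairs.Properties as AllPairs
open import Data.List.Relation.Unary.Unique.Propositional using (Unique)
import Data.List.Relation.Unary.Unique.Propositional.Properties as Unique
open import Data.Maybe.Base using (Maybe; just; nothing)
open import Data.Maybe.Properties using (just-injective)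
open import Data.Nat.Base
open import Data.Nat.Induction using (acc)
open import Data.Nat.ListAction using (product; sum)
open import Data.Nat.ListAction.Properties using (sum-++)
open import Data.Nat.Properties
open import Data.Product.Base using (_×_; _,_; ∃; ∃-syntax; proj₁; proj₂)
open import Data.Sum.Base using (_⊎_; inj₁; inj₂)
open import Data.Vec.Base using ([]; _∷_; lookup; replicate; _[_]≔_)
open import Data.Vec.Properties
  using (lookup-replicate; lookup∘update; lookup∘update′; []≔-idempotent; []≔-lookup)
open import Function.Base using (id; _on_; _∘_)
open import Relation.Binary.Definitions using (DecidableEquality)
open import Relation.Binary.PropositionalEquality
open import Relation.Nullary using (¬_; contradiction; no; yes; ¬?)
open import Relation.Nullary.Decidable using (decidable-stable)
open import Relation.Unary using (Decidable)
open import Algebra.Properties.CommutativeSemigroup *-commutativeSemigroup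
  using (interchange; x∙yz≈y∙xz)
open import Algebra.Properties.CommutativeSemigroup +-commutativeSemigroup
  using () renaming (interchange to +-interchange)
open import Data.List.Extrema ≤-totalOrder using (argmax-sel)
open ≡-Reasoning

-- Levels and the function G

module _ {y : ℕ} where

  #-∷-≡ : ∀ {x} M → y ≡ x → #[ y ] (x ∷ M) ≡ suc (#[ y ] M)
  #-∷-≡ M y≡x = cong length (filter-accept (y ≟_) y≡x)

  #-∷-≢ : ∀ {x} M → y ≢ x → #[ y ] (x ∷ M) ≡ #[ y ] M
  #-∷-≢ M y≢x = cong length (filter-reject (y ≟_) y≢x)

  #-++ : ∀ M N → #[ y ] (M ++ N) ≡ #[ y ] M + #[ y ] N
  #-++ M N = trans (cong length (filter-++ (y ≟_) M N)) (length-++ (filter (y ≟_) M))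

  #-↭ : ∀ {M N} → M ↭ N → #[ y ] M ≡ #[ y ] N
  #-↭ M↭N = ↭-length (filter-↭ (y ≟_) M↭N)

  #-absent : ∀ {M} → All (y ≢_) M → #[ y ] M ≡ 0
  #-absent []               = refl
  #-absent {x ∷ M} (p ∷ ps) = trans (#-∷-≢ M p) (#-absent ps)

2*-cancel : ∀ {m n} → 2 * m ≡ 2 * n → m ≡ n
2*-cancel {m} {n} = *-cancelˡ-≡ m n 2

2*suc : ∀ m → 2 * suc m ≡ suc (suc (2 * m))
2*suc m = cong suc (+-suc m (m + 0))

2*suc∸1 : ∀ m → 2 * suc m ∸ 1 ≡ suc (2 * m)
2*suc∸1 m = cong (_∸ 1) (2*suc m)

odd≢even : ∀ m n → 2 * suc m ∸ 1 ≢ 2 * n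
odd≢even m n e = even≢odd n m (trans (sym e) (2*suc∸1 m))

2*suc∸1-cancel : ∀ {m n} → 2 * suc m ∸ 1 ≡ 2 * suc n ∸ 1 → m ≡ n
2*suc∸1-cancel {m} {n} e =
  2*-cancel (suc-injective (trans (sym (2*suc∸1 m)) (trans e (2*suc∸1 n))))

-- For k ≥ 1, the elements 2k-1 and 2k share one factorial in `G`: an inner gap of either length has
-- its middle at distance k. A gap of length k at an end of the row also reaches distance k, and
-- `S′ k` contains 2k-1 for it.
level : ℕ → Multiset → ℕ
level k M = #[ 2 * k ] M + #[ 2 * k ∸ 1 ] M

level-↭ : ∀ k {M N} → M ↭ N → level k M ≡ level k N
level-↭ k M↭N = cong₂ _+_ (#-↭ M↭N) (#-↭ M↭N)

level-++ : ∀ k M N → level k (M ++ N) ≡ level k M + level k N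
level-++ k M N =
  trans (cong₂ _+_ (#-++ M N) (#-++ M N))
        (+-interchange (#[ 2 * k ] M) _ _ _)

level-small : ∀ k {M} → All (_≤ 2 * k) M → level (suc k) M ≡ 0
level-small k {M} M≤2k = cong₂ _+_ (#-absent (All.map ≢₁ M≤2k)) (#-absent (All.map ≢₂ M≤2k))
  where
  ≢₁ : ∀ {x} → x ≤ 2 * k → 2 * suc k ≢ x
  ≢₁ x≤2k refl = 1+n≰n (≤-trans (n≤1+n _) (subst (_≤ 2 * k) (2*suc k) x≤2k))
  ≢₂ : ∀ {x} → x ≤ 2 * k → 2 * suc k ∸ 1 ≢ x
  ≢₂ x≤2k refl = 1+n≰n (subst (_≤ 2 * k) (2*suc∸1 k) x≤2k)

level-∷-even : ∀ k M → level (suc k) (2 * suc k ∷ M) ≡ suc (level (suc k) M)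
level-∷-even k M = cong₂ _+_ (#-∷-≡ M refl) (#-∷-≢ M (odd≢even k (suc k)))

level-∷-odd : ∀ k M → level (suc k) (2 * suc k ∸ 1 ∷ M) ≡ suc (level (suc k) M)
level-∷-odd k M =
  trans (cong₂ _+_ (#-∷-≢ M (odd≢even k (suc k) ∘ sym)) (#-∷-≡ M refl))
        (+-suc (#[ 2 * suc k ] M) _)

level-∷-even-≢ : ∀ {i k} M → i ≢ k → level (suc i) (2 * suc k ∷ M) ≡ level (suc i) M
level-∷-even-≢ {i} {k} M i≢k =
  cong₂ _+_ (#-∷-≢ M (i≢k ∘ suc-injective ∘ 2*-cancel)) (#-∷-≢ M (odd≢even i (suc k)))

level-∷-odd-≢ : ∀ {i k} M → i ≢ k → level (suc i) (2 * suc k ∸ 1 ∷ M) ≡ level (suc i) M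
level-∷-odd-≢ {i} {k} M i≢k =
  cong₂ _+_ (#-∷-≢ M (odd≢even k (suc i) ∘ sym)) (#-∷-≢ M (i≢k ∘ 2*suc∸1-cancel))

-- Products and sums with a movable cutoff

applyUpTo-cong : ∀ {f g : ℕ → ℕ} → (∀ i → f i ≡ g i) → ∀ n → applyUpTo f n ≡ applyUpTo g n
applyUpTo-cong f≗g zero    = refl
applyUpTo-cong f≗g (suc n) = cong₂ _∷_ (f≗g 0) (applyUpTo-cong (f≗g ∘ suc) n)

module _ (f : ℕ → ℕ) where

  ∏ ∑ : ℕ → ℕ
  ∏ n = product (applyUpTo f n)
  ∑ n = sum (applyUpTo f n)

∏-extend : ∀ f {m n} → m ≤ n → (∀ i → m ≤ i → f i ≡ 1) → ∏ f m ≡ ∏ f n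
∏-extend f {n = zero}  z≤n       f≡1 = refl
∏-extend f {n = suc n} z≤n       f≡1 =
  sym (trans (cong (_* ∏ (f ∘ suc) n) (f≡1 0 z≤n))
             (trans (*-identityˡ _) (sym (∏-extend (f ∘ suc) {n = n} z≤n λ i _ → f≡1 (suc i) z≤n))))
∏-extend f             (s≤s m≤n) f≡1 = cong (f 0 *_) (∏-extend (f ∘ suc) m≤n λ i m≤i → f≡1 (suc i) (s≤s m≤i))

∑-extend : ∀ f {m n} → m ≤ n → (∀ i → m ≤ i → f i ≡ 0) → ∑ f m ≡ ∑ f n
∑-extend f {n = zero}  z≤n       f≡0 = refl
∑-extend f {n = suc n} z≤n       f≡0 =
  sym (trans (cong (_+ ∑ (f ∘ suc) n) (f≡0 0 z≤n))
             (sym (∑-extend (f ∘ suc) {n = n} z≤n λ i _ → f≡0 (suc i) z≤n)))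
∑-extend f             (s≤s m≤n) f≡0 = cong (f 0 +_) (∑-extend (f ∘ suc) m≤n λ i m≤i → f≡0 (suc i) (s≤s m≤i))

∏-update : ∀ {f g} c k {n} → k < n → g k ≡ c * f k → (∀ i → i ≢ k → g i ≡ f i) → ∏ g n ≡ c * ∏ f n
∏-update {f} {g} c zero {suc n} k<n gk g≗f =
  trans (cong₂ _*_ gk (cong product (applyUpTo-cong (λ i → g≗f (suc i) λ ()) n))) (*-assoc c (f 0) _)
∏-update {f} {g} c (suc k) {suc n} (s≤s k<n) gk g≗f =
  trans (cong₂ _*_ (g≗f 0 λ ()) (∏-update c k k<n gk λ i i≢k → g≗f (suc i) (i≢k ∘ suc-injective)))
        (x∙yz≈y∙xz (f 0) c _)

∑-update : ∀ {f g} k {n} → k < n → g k ≡ suc (f k) → (∀ i → i ≢ k → g i ≡ f i) → ∑ g n ≡ suc (∑ f n)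
∑-update {f} {g} zero {suc n} k<n gk g≗f =
  cong₂ _+_ gk (cong sum (applyUpTo-cong (λ i → g≗f (suc i) λ ()) n))
∑-update {f} {g} (suc k) {suc n} (s≤s k<n) gk g≗f =
  trans (cong₂ _+_ (g≗f 0 λ ()) (∑-update k k<n gk λ i i≢k → g≗f (suc i) (i≢k ∘ suc-injective)))
        (+-suc (f 0) _)

-- Index i stands for k = i + 1 in the product and for k = i + 2 in the exponent, whose sum starts
-- at k = 2; hence `b ∸ 1` terms in `G′`.
factor exponent : Multiset → ℕ → ℕ
factor   M i = level (suc i) M !
exponent M i = #[ 2 * (2 + i) ] M

G′ : ℕ → Multiset → ℕ
G′ b M = ∏ (factor M) b * 2 ^ ∑ (exponent M) (b ∸ 1)

map-⋯ : ∀ (f : ℕ → ℕ) a b → map f [ a ⋯ b ] ≡ applyUpTo (λ i → f (a + i)) (suc b ∸ a)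
map-⋯ f a b = trans (cong (map f) (map-upTo (a +_) n)) (map-applyUpTo (a +_) f n)
  where n = suc b ∸ a

G≡G′-max : ∀ M → G M ≡ G′ (max 0 M) M
G≡G′-max M =
  cong₂ (λ ps es → product ps * 2 ^ sum es) (map-⋯ _ 1 (max 0 M)) (map-⋯ _ 2 (max 0 M))

#-large : ∀ {y b M} → b < y → All (_≤ b) M → #[ y ] M ≡ 0
#-large b<y M≤b = #-absent (All.map (λ x≤b y≡x → <⇒≱ b<y (≤-trans (≤-reflexive y≡x) x≤b)) M≤b)

suc≤2*suc∸1 : ∀ i → suc i ≤ 2 * suc i ∸ 1
suc≤2*suc∸1 i = subst (suc i ≤_) (sym (2*suc∸1 i)) (s≤s (m≤n*m i 2))

-- The cutoff in `G` varies with the multiset. Freeing it lets two multisets be compared factor by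
-- factor at a common bound.
G≡G′ : ∀ {b M} → All (_≤ b) M → G M ≡ G′ b M
G≡G′ {b} {M} M≤b = begin
  G M   ≡⟨ G≡G′-max M ⟩
  G′ m M ≡⟨ cong₂ (λ p e → p * 2 ^ e) (∏-extend (factor M) m≤b factor≡1)
                  (∑-extend (exponent M) (∸-monoˡ-≤ 1 m≤b) exponent≡0) ⟩
  G′ b M ∎
  where
  m = max 0 M
  m≤b : m ≤ b
  m≤b = max≤v⁺ z≤n M≤b
  M≤m : All (_≤ m) M
  M≤m = xs≤max 0 M
  factor≡1 : ∀ i → m ≤ i → factor M i ≡ 1
  factor≡1 i m≤i = cong _! (cong₂ _+_
    (#-large (≤-trans (s≤s m≤i) (≤-trans (suc≤2*suc∸1 i) (m∸n≤m _ 1))) M≤m)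
    (#-large (≤-trans (s≤s m≤i) (suc≤2*suc∸1 i)) M≤m))
  exponent≡0 : ∀ i → m ∸ 1 ≤ i → exponent M i ≡ 0
  exponent≡0 i m∸1≤i =
    -- Here m ≤ 1 + (m ∸ 1) ≤ 1 + i, so 2(i + 2) exceeds m, also for m = 0.
    #-large (≤-trans (s≤s (≤-trans (m≤n+m∸n m 1) (s≤s m∸1≤i))) (m≤n*m (2 + i) 2)) M≤m

G-↭ : ∀ {M N} → M ↭ N → G M ≡ G N
G-↭ {M} {N} M↭N = begin
  G M    ≡⟨ G≡G′ M≤b ⟩
  G′ b M ≡⟨ cong₂ (λ p e → product p * 2 ^ sum e)
              (applyUpTo-cong (λ i → cong _! (level-↭ (suc i) M↭N)) b)
              (applyUpTo-cong (λ i → #-↭ M↭N) (b ∸ 1)) ⟩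
  G′ b N ≡⟨ G≡G′ (All-resp-↭ M↭N M≤b) ⟨
  G N    ∎
  where
  b = max 0 M
  M≤b = xs≤max 0 M

-- The factor 2 is for the two midpoints of a gap of even length 2(k+1), which
-- is why it is missing at k = 0: there the second midpoint of the gap is the
-- element 1 of S 2.
midpoints : ℕ → ℕ
midpoints zero    = 1
midpoints (suc _) = 2

private
  reassociate : ∀ l p w e → (l * p) * (w * e) ≡ l * (w * (p * e))
  reassociate l p w e =
    trans (interchange l p w e) (*-assoc l w (p * e))

-- The new element turns the factorial l! at its level into (l + 1)! and, unless it is 2, raises the
-- exponent by one.
G-∷-even : ∀ k M → G (2 * suc k ∷ M) ≡ suc (level (suc k) M) * (midpoints k * G M)
G-∷-even k M = begin
  G M⁺                                          ≡⟨ G≡G′ M⁺≤b ⟩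
  ∏ (factor M⁺) b * 2 ^ ∑ (exponent M⁺) (b ∸ 1) ≡⟨ cong₂ _*_ factors (exponents k b k<b refl) ⟩
  (l * ∏ (factor M) b) * (midpoints k * 2 ^ ∑ (exponent M) (b ∸ 1))
                                                ≡⟨ reassociate l (∏ (factor M) b) (midpoints k) (2 ^ ∑ (exponent M) (b ∸ 1)) ⟩
  l * (midpoints k * G′ b M)                    ≡⟨ cong (λ g → l * (midpoints k * g)) (G≡G′ (All.tail M⁺≤b)) ⟨
  l * (midpoints k * G M)                       ∎
  where
  M⁺ = 2 * suc k ∷ M
  b = max 0 M⁺
  l = suc (level (suc k) M)
  M⁺≤b = xs≤max 0 M⁺
  k<b : k < b
  k<b = ≤-trans (m≤n*m (suc k) 2) (All.head M⁺≤b)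
  factors : ∏ (factor M⁺) b ≡ l * ∏ (factor M) b
  factors = ∏-update l k k<b (cong _! (level-∷-even k M))
                     (λ i i≢k → cong _! (level-∷-even-≢ M i≢k))
  -- `j` and this `b` are variables, so that matching evaluates `midpoints j` and `b ∸ 1`.
  exponents : ∀ j b → j < b → j ≡ k →
    2 ^ ∑ (exponent M⁺) (b ∸ 1) ≡ midpoints j * 2 ^ ∑ (exponent M) (b ∸ 1)
  exponents zero    b       _         refl =
    trans (cong (λ es → 2 ^ sum es)
                (applyUpTo-cong (λ i → #-∷-≢ M (0≢1+n ∘ sym ∘ suc-injective ∘ 2*-cancel {2 + i} {1})) (b ∸ 1)))
          (sym (*-identityˡ _))
  exponents (suc j) (suc b) (s≤s j<b) refl =
    cong (2 ^_) (∑-update j j<b (#-∷-≡ M refl)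
                          λ i i≢j → #-∷-≢ M (i≢j ∘ suc-injective ∘ suc-injective ∘ 2*-cancel {2 + i} {2 + j}))

-- An odd element enters only the factorial of its level, never the exponent.
G-∷-odd : ∀ k M → G (2 * suc k ∸ 1 ∷ M) ≡ suc (level (suc k) M) * G M
G-∷-odd k M = begin
  G M⁺                                          ≡⟨ G≡G′ M⁺≤b ⟩
  ∏ (factor M⁺) b * 2 ^ ∑ (exponent M⁺) (b ∸ 1) ≡⟨ cong₂ _*_ factors exponents ⟩
  (l * ∏ (factor M) b) * 2 ^ ∑ (exponent M) (b ∸ 1) ≡⟨ *-assoc l (∏ (factor M) b) (2 ^ ∑ (exponent M) (b ∸ 1)) ⟩
  l * G′ b M                                    ≡⟨ cong (l *_) (G≡G′ (All.tail M⁺≤b)) ⟨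
  l * G M                                       ∎
  where
  M⁺ = 2 * suc k ∸ 1 ∷ M
  b = max 0 M⁺
  l = suc (level (suc k) M)
  M⁺≤b = xs≤max 0 M⁺
  k<b : k < b
  k<b = ≤-trans (suc≤2*suc∸1 k) (All.head M⁺≤b)
  factors : ∏ (factor M⁺) b ≡ l * ∏ (factor M) b
  factors = ∏-update l k k<b (cong _! (level-∷-odd k M))
                     (λ i i≢k → cong _! (level-∷-odd-≢ M i≢k))
  exponents : 2 ^ ∑ (exponent M⁺) (b ∸ 1) ≡ 2 ^ ∑ (exponent M) (b ∸ 1)
  exponents = cong (λ es → 2 ^ sum es)
    (applyUpTo-cong (λ i → #-∷-≢ M (odd≢even k (2 + i) ∘ sym)) (b ∸ 1))

-- This positivity later yields a payphone of positive weight, hence one at the greatest distance.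
G≢0 : ∀ M → NonZero (G M)
G≢0 M = subst NonZero (sym (G≡G′-max M))
  (m*n≢0 (∏ (factor M) b) _ {{∏≢0 (factor M) (λ i → level (suc i) M !≢0) b}} {{m^n≢0 2 (∑ (exponent M) (b ∸ 1))}})
  where
  b = max 0 M
  ∏≢0 : ∀ f → (∀ i → NonZero (f i)) → ∀ n → NonZero (∏ f n)
  ∏≢0 f f≢0 zero    = _
  ∏≢0 f f≢0 (suc n) = m*n≢0 (f 0) _ {{f≢0 0}} {{∏≢0 (f ∘ suc) (f≢0 ∘ suc) n}}

-- The removed element accounts for the last factor of the factorial at its level and for
-- `midpoints k`.
level*G-even : ∀ k {M N} → M ↭ 2 * suc k ∷ N → level (suc k) M * (midpoints k * G N) ≡ G M
level*G-even k {M} {N} M↭ =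
  trans (cong (_* (midpoints k * G N)) (trans (level-↭ (suc k) M↭) (level-∷-even k N)))
        (sym (trans (G-↭ M↭) (G-∷-even k N)))

level*G-odd : ∀ k {M N} → M ↭ 2 * suc k ∸ 1 ∷ N → level (suc k) M * G N ≡ G M
level*G-odd k {M} {N} M↭ =
  trans (cong (_* G N) (trans (level-↭ (suc k) M↭) (level-∷-odd k N)))
        (sym (trans (G-↭ M↭) (G-∷-odd k N)))

-- Gaps

S-acc-≤ : ∀ n a → All (_≤ n) (S-acc n a)
S-acc-≤ zero    _        = []
S-acc-≤ (suc m) (acc rs) = ≤-refl ∷ All.++⁺
  (All.map (λ x≤ → ≤-trans x≤ (≤-trans (⌊n/2⌋≤n m) (n≤1+n m))) (S-acc-≤ ⌊ m /2⌋ _))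
  (All.map (λ x≤ → ≤-trans x≤ (≤-trans (⌈n/2⌉≤n m) (n≤1+n m))) (S-acc-≤ ⌈ m /2⌉ _))

S-≤ : ∀ {n b} → n ≤ b → All (_≤ b) (S n)
S-≤ {n} n≤b = All.map (λ x≤n → ≤-trans x≤n n≤b) (S-acc-≤ n _)

S′-≤ : ∀ {l b} → l ≤ b → All (_≤ 2 * b) (S′ l)
S′-≤ {zero}  l≤b = []
S′-≤ {suc m} {b} l≤b = All.++⁺
  (S-≤ (≤-trans (≤-trans (n≤1+n m) l≤b) (m≤n*m b 2)))
  (≤-trans (m∸n≤m _ 1) (*-monoʳ-≤ 2 l≤b) ∷ [])

⌊2*n/2⌋≡n : ∀ n → ⌊ 2 * n /2⌋ ≡ n
⌊2*n/2⌋≡n n = trans (cong (λ m → ⌊ n + m /2⌋) (+-identityʳ n)) (sym (n≡⌊n+n/2⌋ n))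

⌈2*n/2⌉≡n : ∀ n → ⌈ 2 * n /2⌉ ≡ n
⌈2*n/2⌉≡n n = trans (cong (λ m → ⌈ n + m /2⌉) (+-identityʳ n)) (sym (n≡⌈n+n/2⌉ n))

S-odd : ∀ q → S (suc (2 * q)) ≡ 2 * suc q ∸ 1 ∷ S q ++ S q
S-odd q = trans (S-suc (2 * q))
  (cong₂ _∷_ (sym (2*suc∸1 q)) (cong₂ (λ m n → S m ++ S n) (⌊2*n/2⌋≡n q) (⌈2*n/2⌉≡n q)))

S-even : ∀ q → S (suc (suc (2 * q))) ≡ 2 * suc q ∷ S q ++ S (suc q)
S-even q = trans (S-suc (suc (2 * q)))
  (cong₂ _∷_ (sym (2*suc q)) (cong₂ (λ m n → S m ++ S n) (⌈2*n/2⌉≡n q) (cong suc (⌊2*n/2⌋≡n q))))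

S-head : ∀ {b} n → All (_≤ b) (S n) → n ≤ b
S-head zero    _         = z≤n
S-head (suc n) (n<b ∷ _) = n<b

-- For l ≥ 1 the last element of `S′ l` is 2l - 1, and 2l - 1 ≤ 2k gives l ≤ k by parity.
S′-last : ∀ {k} l → All (_≤ 2 * k) (S′ l) → l ≤ k
S′-last     zero    _  = z≤n
S′-last {k} (suc m) ps =
  *-cancelˡ-< 2 m k (subst (_≤ 2 * k) (2*suc∸1 m) (All.head (All.++⁻ʳ (S m) ps)))

-- A gap is a maximal run of available payphones; the Booleans say whether it
-- is bounded by an occupied payphone on its left and on its right.
value : Bool → Bool → ℕ → Multiset
value true  true  g = S g
value true  false g = S′ g
value false true  g = S′ g
value false false g = []

-- For an available payphone with i available ones before it and j after it
-- in its gap; the last clause is a junk value.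
distance : Bool → Bool → ℕ → ℕ → ℕ
distance true  true  i j = suc (i ⊓ j)
distance true  false i j = suc i
distance false true  i j = suc j
distance false false i j = 0

-- Payphones at other distances keep weight 0, so that sums can run over all positions.
hit : ℕ → ℕ → ℕ → ℕ
hit k d w with d ≟ k
... | yes _ = w
... | no  _ = 0

hit-≡ : ∀ {k d} w → d ≡ k → hit k d w ≡ w
hit-≡ {k} {d} w d≡k with d ≟ k
... | yes _   = refl
... | no  d≢k = contradiction d≡k d≢k

hit-≢ : ∀ {k d} w → d ≢ k → hit k d w ≡ 0
hit-≢ {k} {d} w d≢k with d ≟ k
... | yes d≡k = contradiction d≡k d≢k
... | no  _   = refl

-- A sum over the last j positions of a gap of length i + j; `f` receives the numbers of positions
-- before and after the current one.
diagonal : (ℕ → ℕ → ℕ) → ℕ → ℕ → ℕ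
diagonal f i zero    = 0
diagonal f i (suc j) = f i j + diagonal f (suc i) j

diagonal-zero : ∀ f i j → (∀ i′ j′ → i′ < i + j → j′ < j → f i′ j′ ≡ 0) → diagonal f i j ≡ 0
diagonal-zero f i zero    f≡0 = refl
diagonal-zero f i (suc j) f≡0 = cong₂ _+_ (f≡0 i j (m<m+n i z<s) ≤-refl)
  (diagonal-zero f (suc i) j λ i′ j′ i′< j′<j →
    f≡0 i′ j′ (subst (i′ <_) (sym (+-suc i j)) i′<) (m<n⇒m<1+n j′<j))

-- Cuts the sum after m positions, to separate those near the left end of a gap from the middle.
diagonal-+ : ∀ f i m n →
  diagonal f i (m + n) ≡ diagonal (λ i j → f i (j + n)) i m + diagonal f (i + m) n
diagonal-+ f i zero    n = cong (λ i → diagonal f i n) (sym (+-identityʳ i))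
diagonal-+ f i (suc m) n = begin
  f i (m + n) + diagonal f (suc i) (m + n)
    ≡⟨ cong (f i (m + n) +_) (diagonal-+ f (suc i) m n) ⟩
  f i (m + n) + (diagonal f′ (suc i) m + diagonal f (suc i + m) n)
    ≡⟨ +-assoc (f i (m + n)) (diagonal f′ (suc i) m) _ ⟨
  f i (m + n) + diagonal f′ (suc i) m + diagonal f (suc i + m) n
    ≡⟨ cong (λ i′ → f i (m + n) + diagonal f′ (suc i) m + diagonal f i′ n) (+-suc i m) ⟨
  f i (m + n) + diagonal f′ (suc i) m + diagonal f (i + suc m) n ∎
  where f′ = λ i j → f i (j + n)

-- Taking a payphone splits its gap into two parts, both bounded by the newly occupied payphone.
atDistance : ℕ → (Multiset → ℕ) → Bool → Bool → ℕ → ℕ → ℕ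
atDistance k w L R i j = hit k (distance L R i j) (w (value L true i ++ value true R j))

-- For a single gap of a row: `w X` will be `G` of the whole multiset with the value of this gap
-- replaced by `X`, `l` the number of elements of the whole multiset at level q + 1, and `T` its
-- `G`.
module _ (w : Multiset → ℕ) (w-resp-↭ : ∀ {X Y} → X ↭ Y → w X ≡ w Y)
         (l T q : ℕ) where

  private
    f : Bool → Bool → ℕ → ℕ → ℕ
    f = atDistance (suc q) w

    Σ : Bool → Bool → ℕ → ℕ
    Σ L R = diagonal (f L R) 0

    ≢suc : ∀ {d} → d < q → suc d ≢ suc q
    ≢suc d<q e = <⇒≢ d<q (suc-injective e)

    before-middle : ∀ n → diagonal (λ i j → f true true i (j + n)) 0 q ≡ 0
    before-middle n = diagonal-zero _ 0 q λ i j i<q _ →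
      hit-≢ _ (≢suc (≤-<-trans (m⊓n≤m i (j + n)) i<q))

    after-middle : ∀ i → diagonal (f true true) i q ≡ 0
    after-middle i = diagonal-zero _ i q λ i j _ j<q →
      hit-≢ _ (≢suc (≤-<-trans (m⊓n≤n i j) j<q))

    -- The first q positions are too close to the left end, the remaining ones, at most q, too close
    -- to the right end.
    inner-small : ∀ {g} → g ≤ 2 * q → Σ true true g ≡ 0
    inner-small {g} g≤2q = begin
      Σ true true g ≡⟨ cong (Σ true true) (m⊓n+n∸m≡n q g) ⟨
      Σ true true (q ⊓ g + (g ∸ q)) ≡⟨ diagonal-+ (f true true) 0 (q ⊓ g) (g ∸ q) ⟩
      _ ≡⟨ cong₂ _+_
        (diagonal-zero _ 0 (q ⊓ g) λ i j i< _ →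
          hit-≢ _ (≢suc (≤-<-trans (m⊓n≤m i _) (≤-trans i< (m⊓n≤m q g)))))
        (diagonal-zero _ (q ⊓ g) (g ∸ q) λ i j _ j< →
          hit-≢ _ (≢suc (≤-<-trans (m⊓n≤n i j) (≤-trans j< g∸q≤q)))) ⟩
      0 ∎
      where
      g∸q≤q : g ∸ q ≤ q
      g∸q≤q = m≤n+o⇒m∸n≤o g q (subst (g ≤_) (cong (q +_) (+-identityʳ q)) g≤2q)

    -- Only the middle position, with q positions on either side, is at distance q + 1.
    inner-odd : Σ true true (suc (2 * q)) ≡ w (S q ++ S q)
    inner-odd = begin
      Σ true true (suc (2 * q))
        ≡⟨ cong (Σ true true) (trans (cong (λ m → suc (q + m)) (+-identityʳ q)) (sym (+-suc q q))) ⟩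
      Σ true true (q + suc q)
        ≡⟨ diagonal-+ (f true true) 0 q (suc q) ⟩
      _ ≡⟨ cong₂ _+_ (before-middle (suc q))
             (cong₂ _+_ (hit-≡ _ (cong suc (⊓-idem q))) (after-middle (suc q))) ⟩
      w (S q ++ S q) + 0
        ≡⟨ +-identityʳ _ ⟩
      w (S q ++ S q) ∎

    -- Both middle positions are at distance q + 1. Their splits agree up to order, which is where
    -- `w-resp-↭` enters.
    inner-even : Σ true true (suc (suc (2 * q))) ≡ 2 * w (S q ++ S (suc q))
    inner-even = begin
      Σ true true (suc (suc (2 * q)))
        ≡⟨ cong (Σ true true) (trans (cong (λ m → suc (suc (q + m))) (+-identityʳ q))
                                     (sym (trans (+-suc q (suc q)) (cong suc (+-suc q q))))) ⟩
      Σ true true (q + suc (suc q))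
        ≡⟨ diagonal-+ (f true true) 0 q (suc (suc q)) ⟩
      _ ≡⟨ cong₂ _+_ (before-middle (suc (suc q)))
             (cong₂ _+_ (hit-≡ _ (cong suc (m≤n⇒m⊓n≡m (n≤1+n q))))
             (cong₂ _+_ (trans (hit-≡ _ (cong suc (m≥n⇒m⊓n≡n (n≤1+n q))))
                               (w-resp-↭ (++-comm (S (suc q)) (S q))))
                        (after-middle (suc (suc q))))) ⟩
      2 * w (S q ++ S (suc q)) ∎

    edge-left-small : ∀ {g} → g ≤ q → Σ false true g ≡ 0
    edge-left-small g≤q = diagonal-zero _ 0 _ λ i j _ j< → hit-≢ _ (≢suc (≤-trans j< g≤q))

    edge-left : Σ false true (suc q) ≡ w (S q)
    edge-left = trans
      (cong₂ _+_ (hit-≡ _ refl) (diagonal-zero _ 1 q λ i j _ j<q → hit-≢ _ (≢suc j<q)))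
      (+-identityʳ _)

    edge-right-small : ∀ {g} → g ≤ q → Σ true false g ≡ 0
    edge-right-small g≤q = diagonal-zero _ 0 _ λ i j i< _ → hit-≢ _ (≢suc (≤-trans i< g≤q))

    -- Only the last payphone of the row is at distance q + 1; to its right it leaves `S′ 0`, which
    -- is empty.
    edge-right : Σ true false (suc q) ≡ w (S q)
    edge-right = begin
      Σ true false (suc q)   ≡⟨ cong (Σ true false) (+-comm 1 q) ⟩
      Σ true false (q + 1)   ≡⟨ diagonal-+ (f true false) 0 q 1 ⟩
      _ ≡⟨ cong₂ _+_ (diagonal-zero _ 0 q λ i j i<q _ → hit-≢ _ (≢suc i<q))
                     (cong (_+ 0) (hit-≡ _ refl)) ⟩
      w (S q ++ []) + 0      ≡⟨ +-identityʳ _ ⟩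
      w (S q ++ [])          ≡⟨ cong w (++-identityʳ (S q)) ⟩
      w (S q)                ∎

    -- These are the cases of no, one and two positions at distance q + 1.
    S-bounds : ∀ {g} → g ≤ 2 * suc q → g ≤ 2 * q ⊎ g ≡ suc (2 * q) ⊎ g ≡ suc (suc (2 * q))
    S-bounds {g} g≤ with m≤n⇒m<n∨m≡n (subst (g ≤_) (2*suc q) g≤)
    ... | inj₂ g≡         = inj₂ (inj₂ g≡)
    ... | inj₁ (s≤s g≤′) with m≤n⇒m<n∨m≡n g≤′
    ...   | inj₂ g≡         = inj₂ (inj₁ g≡)
    ...   | inj₁ (s≤s g≤2q) = inj₁ g≤2q

    S-top : ∀ m n → m ≤ 2 * q → n ≤ 2 * q → level (suc q) (S m ++ S n) ≡ 0
    S-top m n m≤ n≤ = level-small q (All.++⁺ (S-≤ m≤) (S-≤ n≤))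

    level-S-odd : level (suc q) (S (suc (2 * q))) ≡ 1
    level-S-odd = trans (cong (level (suc q)) (S-odd q))
      (trans (level-∷-odd q (S q ++ S q)) (cong suc (S-top q q (m≤n*m q 2) (m≤n*m q 2))))

    level-S′ : level (suc q) (S′ (suc q)) ≡ 1
    level-S′ = trans (level-↭ (suc q) (++-comm (S q) _))
      (trans (level-∷-odd q (S q)) (cong suc (level-small q (S-≤ (m≤n*m q 2)))))

    zero-zero : ∀ {s t} → s ≡ 0 → t ≡ 0 → l * s ≡ t * T
    zero-zero refl refl = *-zeroʳ l

  -- Both sides count a gap by its elements at level q + 1; for q = 0 those
  -- are all its elements, for larger q only the greatest one can be.
  gap-total : ∀ L R g →
    (∀ {X} → value L R g ↭ 2 * suc q ∷ X → l * (midpoints q * w X) ≡ T) →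
    (∀ {X} → value L R g ↭ 2 * suc q ∸ 1 ∷ X → l * w X ≡ T) →
    All (_≤ 2 * suc q) (value L R g) →
    l * Σ L R g ≡ level (suc q) (value L R g) * T
  gap-total true true g even odd fits with S-bounds (S-head g fits)
  ... | inj₁ g≤2q        = zero-zero (inner-small g≤2q) (level-small q (S-≤ g≤2q))
  ... | inj₂ (inj₁ refl) = begin
    l * Σ true true (suc (2 * q)) ≡⟨ cong (l *_) inner-odd ⟩
    l * w (S q ++ S q)            ≡⟨ odd (↭-reflexive (S-odd q)) ⟩
    T                             ≡⟨ *-identityˡ T ⟨
    1 * T                         ≡⟨ cong (_* T) level-S-odd ⟨
    level (suc q) (S (suc (2 * q))) * T ∎
  ... | inj₂ (inj₂ refl) =
    trans (cong (l *_) inner-even) (by-midpoints q refl (even (↭-reflexive (S-even q))))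
    where
    X = S q ++ S (suc q)
    by-midpoints : ∀ p → p ≡ q → l * (midpoints p * w X) ≡ T →
      l * (2 * w X) ≡ level (suc q) (S (suc (suc (2 * q)))) * T
    -- The gap has length 2, and both elements 2 and 1 of `S 2` are at level 1: each of the two
    -- payphones contributes T.
    by-midpoints zero refl lw≡T = begin
      l * (2 * w X)                ≡⟨ *-distribˡ-+ l (w X) _ ⟩
      l * w X + l * (1 * w X)      ≡⟨ cong (_+ l * (1 * w X)) (cong (l *_) (sym (*-identityˡ (w X)))) ⟩
      l * (1 * w X) + l * (1 * w X) ≡⟨ cong₂ _+_ lw≡T (trans lw≡T (sym (+-identityʳ T))) ⟩
      2 * T                        ∎
    -- Now q + 1 ≤ 2q, so 2(q + 1) is the only element at level q + 1, and the two payphones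
    -- contribute T together.
    by-midpoints (suc p) refl lw≡T = begin
      l * (2 * w X)           ≡⟨ lw≡T ⟩
      T                       ≡⟨ *-identityˡ T ⟨
      1 * T                   ≡⟨ cong (λ t → suc t * T) (S-top q (suc q) (m≤n*m q 2)
                                   (subst (suc q ≤_) (sym (2*suc p)) (s≤s (s≤s (m≤n*m p 2))))) ⟨
      suc (level (suc q) X) * T ≡⟨ cong (_* T) (level-∷-even q X) ⟨
      level (suc q) (2 * suc q ∷ X) * T ≡⟨ cong (λ Y → level (suc q) Y * T) (S-even q) ⟨
      level (suc q) (S (suc (suc (2 * q)))) * T ∎
  gap-total true false g even odd fits with m≤n⇒m<n∨m≡n (S′-last {suc q} g fits)
  ... | inj₁ (s≤s g≤q) = zero-zero (edge-right-small g≤q) (level-small q (S′-≤ g≤q))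
  ... | inj₂ refl = trans (cong (l *_) edge-right) (trans (odd (++-comm (S q) (2 * suc q ∸ 1 ∷ [])))
    (sym (trans (cong (_* T) level-S′) (*-identityˡ T))))
  gap-total false true g even odd fits with m≤n⇒m<n∨m≡n (S′-last {suc q} g fits)
  ... | inj₁ (s≤s g≤q) = zero-zero (edge-left-small g≤q) (level-small q (S′-≤ g≤q))
  ... | inj₂ refl = trans (cong (l *_) edge-left) (trans (odd (++-comm (S q) (2 * suc q ∸ 1 ∷ [])))
    (sym (trans (cong (_* T) level-S′) (*-identityˡ T))))
  -- The junk distance 0 is never q + 1, and the value is empty.
  gap-total false false g even odd fits =
    zero-zero (diagonal-zero _ 0 g λ i j _ _ → refl) refl

infixr 5 _▷_

-- The lengths of the gaps of a row from left to right, those between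
-- adjacent occupied payphones included (as 0).
data Gaps : Set where
  last : ℕ → Gaps
  _▷_  : ℕ → Gaps → Gaps

multiset : Bool → Gaps → Multiset
multiset L (last g) = value L false g
multiset L (g ▷ γ)  = value L true g ++ multiset true γ

-- The state of a scan from left to right: `C` collects the values of the gaps already passed, and i
-- payphones of the current gap have been passed.
hits : ℕ → Bool → ℕ → Multiset → Gaps → ℕ
hits k L i C (last j) = diagonal (atDistance k (λ X → G (C ++ X)) L false) i j
hits k L i C (j ▷ γ)  =
  diagonal (atDistance k (λ X → G (C ++ X ++ multiset true γ)) L true) i j
    + hits k true 0 (C ++ value L true (i + j)) γ

replace-in-context : ∀ (C N : Multiset) {V x} X → V ↭ x ∷ X → C ++ V ++ N ↭ x ∷ C ++ X ++ N
replace-in-context C N {x = x} X V↭ = ↭-trans (++⁺ˡ C (++⁺ʳ N V↭)) (shift x C (X ++ N))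

-- Each gap contributes its share by `gap-total`, with all other gaps as context; the value of a
-- passed gap moves into `C`, and levels add up.
hits-total : ∀ q L C γ → All (_≤ 2 * suc q) (multiset L γ) →
  level (suc q) (C ++ multiset L γ) * hits (suc q) L 0 C γ
    ≡ level (suc q) (multiset L γ) * G (C ++ multiset L γ)
hits-total q L C (last g) fits =
  gap-total (λ X → G (C ++ X)) (λ X↭Y → G-↭ (++⁺ˡ C X↭Y)) (level (suc q) M) (G M) q L false g
    (λ {X} V↭ → level*G-even q {M} {C ++ X} (in-context X V↭)) (λ {X} V↭ → level*G-odd q {M} {C ++ X} (in-context X V↭)) fits
  where
  M = C ++ value L false g
  in-context : ∀ {x} X → value L false g ↭ x ∷ X → M ↭ x ∷ C ++ X
  in-context {x} X V↭ = ↭-trans (++⁺ˡ C V↭) (shift x C X)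
hits-total q L C (g ▷ γ) fits = begin
  l * (Σg + hits (suc q) true 0 (C ++ V) γ)
    ≡⟨ *-distribˡ-+ l Σg _ ⟩
  l * Σg + l * hits (suc q) true 0 (C ++ V) γ
    ≡⟨ cong₂ _+_ this-gap other-gaps ⟩
  level (suc q) V * G M + level (suc q) N * G M
    ≡⟨ *-distribʳ-+ (G M) (level (suc q) V) (level (suc q) N) ⟨
  (level (suc q) V + level (suc q) N) * G M
    ≡⟨ cong (_* G M) (level-++ (suc q) V N) ⟨
  level (suc q) (V ++ N) * G M ∎
  where
  V = value L true g
  N = multiset true γ
  M = C ++ V ++ N
  l = level (suc q) M
  w = λ X → G (C ++ X ++ N)
  Σg = diagonal (atDistance (suc q) w L true) 0 g
  this-gap : l * Σg ≡ level (suc q) V * G M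
  this-gap = gap-total w (λ X↭Y → G-↭ (++⁺ˡ C (++⁺ʳ N X↭Y))) l (G M) q L true g
    (λ {X} V↭ → level*G-even q {M} {C ++ X ++ N} (replace-in-context C N X V↭))
    (λ {X} V↭ → level*G-odd q {M} {C ++ X ++ N} (replace-in-context C N X V↭))
    (All.++⁻ˡ V fits)
  other-gaps : l * hits (suc q) true 0 (C ++ V) γ ≡ level (suc q) N * G M
  other-gaps = subst
    (λ M → level (suc q) M * hits (suc q) true 0 (C ++ V) γ ≡ level (suc q) N * G M)
    (++-assoc C V N) (hits-total q true (C ++ V) γ (All.++⁻ʳ V fits))

-- Rows

infixr 6 _⊕_

_⊕_ : ℕ → Gaps → Gaps
i ⊕ last g  = last (i + g)
i ⊕ (g ▷ γ) = (i + g) ▷ γ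

⊕-identityˡ : ∀ γ → 0 ⊕ γ ≡ γ
⊕-identityˡ (last g) = refl
⊕-identityˡ (g ▷ γ)  = refl

⊕-suc : ∀ i γ → i ⊕ 1 ⊕ γ ≡ suc i ⊕ γ
⊕-suc i (last g) = cong last (+-suc i g)
⊕-suc i (g ▷ γ)  = cong (_▷ γ) (+-suc i g)

gaps : ∀ {n} → Row n → Gaps
gaps []            = last 0
gaps (nothing ∷ r) = 1 ⊕ gaps r
gaps (just _ ∷ r)  = 0 ▷ gaps r

-- The gaps are those of the part of the row after the payphone: the first is what remains of its
-- own gap, and the constructor tells whether an occupied payphone follows.
distanceTo : Bool → ℕ → Gaps → ℕ
distanceTo L i (last j) = distance L false i j
distanceTo L i (j ▷ _)  = distance L true i j

-- One step of the scan: the next payphone of the current gap is split off.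
hits-⊕ : ∀ k L i C γ →
  hits k L i C (1 ⊕ γ)
    ≡ hit k (distanceTo L i γ) (G (C ++ value L true (i + 0) ++ multiset true γ)) + hits k L (suc i) C γ
hits-⊕ k L i C (last j) rewrite +-identityʳ i = refl
hits-⊕ k L i C (j ▷ γ)  rewrite +-identityʳ i | +-suc i j =
  trans (cong (λ N → hit k (distance L true i j) (G (C ++ N)) + later + rest)
              (++-assoc (value L true i) (value true true j) (multiset true γ)))
        (+-assoc (hit k (distance L true i j) _) later rest)
  where
  later = diagonal (atDistance k (λ X → G (C ++ X ++ multiset true γ)) L true) (suc i) j
  rest  = hits k true 0 (C ++ value L true (suc i + j)) γ

-- The distance from payphone j of r to the closest occupied one if r follows
-- i available payphones, with an occupied one before these if L is true.
dist : ∀ {n} → Bool → ℕ → Row n → Fin n → ℕ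
dist L i (_ ∷ r)       zero    = distanceTo L i (gaps r)
dist L i (nothing ∷ r) (suc j) = dist L (suc i) r j
dist L i (just _ ∷ r)  (suc j) = dist true 0 r j

ifAvailable : Maybe ℕ → ℕ → ℕ
ifAvailable nothing  w = w
ifAvailable (just _) w = 0

weightAt : ∀ {n} → ℕ → ℕ → Bool → ℕ → Multiset → Row n → Fin n → ℕ
weightAt p k L i C r j =
  ifAvailable (lookup r j)
    (hit k (dist L i r j) (G (C ++ multiset L (i ⊕ gaps (r [ j ]≔ just p)))))

-- Passes from a sum over payphones to a sum over gaps. An available payphone increments i; an
-- occupied one closes the gap, whose value joins `C`.
sum-weightAt : ∀ {n} p k L i C (r : Row n) → sum (tabulate (weightAt p k L i C r)) ≡ hits k L i C (gaps r)
sum-weightAt p k L i C [] = refl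
sum-weightAt p k L i C (nothing ∷ r) = begin
  weightAt p k L i C (nothing ∷ r) zero + sum (tabulate (weightAt p k L i C (nothing ∷ r) ∘ suc))
    ≡⟨ cong (λ ws → weightAt p k L i C (nothing ∷ r) zero + sum ws) (tabulate-cong λ j →
         cong (λ γ → ifAvailable (lookup r j) (hit k (dist L (suc i) r j) (G (C ++ multiset L γ))))
              (⊕-suc i (gaps (r [ j ]≔ just p)))) ⟩
  weightAt p k L i C (nothing ∷ r) zero + sum (tabulate (weightAt p k L (suc i) C r))
    ≡⟨ cong (weightAt p k L i C (nothing ∷ r) zero +_) (sum-weightAt p k L (suc i) C r) ⟩
  weightAt p k L i C (nothing ∷ r) zero + hits k L (suc i) C (gaps r)
    ≡⟨ hits-⊕ k L i C (gaps r) ⟨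
  hits k L i C (1 ⊕ gaps r) ∎
sum-weightAt p k L i C (just x ∷ r) = begin
  sum (tabulate (weightAt p k L i C (just x ∷ r) ∘ suc))
    ≡⟨ cong sum (tabulate-cong λ j →
         cong (λ M → ifAvailable (lookup r j) (hit k (dist true 0 r j) (G M)))
              (trans (sym (++-assoc C V _))
                     (cong (λ γ → (C ++ V) ++ multiset true γ) (sym (⊕-identityˡ (gaps (r [ j ]≔ just p))))))) ⟩
  sum (tabulate (weightAt p k true 0 (C ++ V) r))
    ≡⟨ sum-weightAt p k true 0 (C ++ V) r ⟩
  hits k true 0 (C ++ V) (gaps r) ∎
  where V = value L true (i + 0)

distance-≤ : ∀ {k} L R i j → All (_≤ 2 * k) (value L R (i + suc j)) → distance L R i j ≤ k
distance-≤ {k} true true i j fits with suc (i ⊓ j) ≤? k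
... | yes d≤k = d≤k
-- Otherwise i and j are both at least k, and the gap length i + 1 + j, an element of its value,
-- exceeds 2k.
... | no  d≰k = contradiction (S-head _ fits) (<⇒≱
  (subst (_< i + suc j) (cong (k +_) (sym (+-identityʳ k)))
    (+-mono-≤-< (≤-trans k≤ (m⊓n≤m i j)) (s≤s (≤-trans k≤ (m⊓n≤n i j))))))
  where
  k≤ : k ≤ i ⊓ j
  k≤ = s≤s⁻¹ (≰⇒> d≰k)
distance-≤ true  false i j fits =
  ≤-trans (≤-trans (s≤s (m≤m+n i j)) (≤-reflexive (sym (+-suc i j)))) (S′-last _ fits)
distance-≤ false true  i j fits = ≤-trans (m≤n+m (suc j) i) (S′-last _ fits)
distance-≤ false false i j fits = z≤n

dist-≤ : ∀ {n k} L i (r : Row n) j → All (_≤ 2 * k) (multiset L (i ⊕ gaps r)) → Available r j → dist L i r j ≤ k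
dist-≤ L i (nothing ∷ r) zero fits _ with gaps r
... | last j = distance-≤ L false i j fits
... | j ▷ γ  = distance-≤ L true i j (All.++⁻ˡ (value L true (i + suc j)) fits)
dist-≤ {k = k} L i (nothing ∷ r) (suc j) fits avail =
  dist-≤ L (suc i) r j (subst (λ γ → All (_≤ 2 * k) (multiset L γ)) (⊕-suc i (gaps r)) fits) avail
dist-≤ {k = k} L i (just _ ∷ r) (suc j) fits avail =
  dist-≤ true 0 r j
    (subst (λ γ → All (_≤ 2 * k) (multiset true γ)) (sym (⊕-identityˡ (gaps r)))
           (All.++⁻ʳ (value L true (i + 0)) fits))
    avail

-- Recursive distance and distance to the occupied payphones

Occupied : ∀ {n} → Row n → Fin n → Set
Occupied r j = ¬ Available r j

-- Indexing by the gaps lets one match reveal both the first gap and the first occupied payphone.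
data FirstOccupied {n} (r : Row n) : Gaps → Set where
  none : ∀ {g} → (∀ j → Available r j) → FirstOccupied r (last g)
  at   : ∀ {γ} j → Occupied r j → (∀ m → Occupied r m → toℕ j ≤ toℕ m) → FirstOccupied r (toℕ j ▷ γ)

firstOccupied : ∀ {n} (r : Row n) → FirstOccupied r (gaps r)
firstOccupied []           = none λ ()
firstOccupied (just _ ∷ r) = at zero (λ ()) λ _ _ → z≤n
firstOccupied (nothing ∷ r) with gaps r | firstOccupied r
... | _ | none avail = none λ { zero → refl ; (suc j) → avail j }
... | _ | at j occ first = at (suc j) occ
  λ { zero occ₀ → contradiction refl occ₀ ; (suc m) occₘ → s≤s (first m occₘ) }

-- The first component concerns the occupied payphone that lies i + 1 places before the start of `r`
-- if `L` is true.
dist-lower : ∀ {n} L i (r : Row n) j → Available r j →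
  (L ≡ true → dist L i r j ≤ suc (i + toℕ j)) ×
  (∀ m → Occupied r m → dist L i r j ≤ ∣ toℕ m - toℕ j ∣)
dist-lower L i (nothing ∷ r) zero _ with gaps r | firstOccupied r
dist-lower true i (nothing ∷ r) zero _ | _ | none avail =
  (λ _ → s≤s (m≤m+n i 0)) ,
  λ { zero occ → contradiction refl occ ; (suc m) occ → contradiction (avail m) occ }
dist-lower false i (nothing ∷ r) zero _ | _ | none avail = (λ ()) , λ _ _ → z≤n
dist-lower true i (nothing ∷ r) zero _ | _ | at j _ first =
  (λ _ → s≤s (≤-trans (m⊓n≤m i _) (m≤m+n i 0))) ,
  λ { zero occ → contradiction refl occ
    ; (suc m) occ → s≤s (≤-trans (m⊓n≤n i _) (first m occ)) }
dist-lower false i (nothing ∷ r) zero _ | _ | at j _ first =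
  (λ ()) ,
  λ { zero occ → contradiction refl occ ; (suc m) occ → s≤s (first m occ) }
dist-lower L i (nothing ∷ r) (suc j) avail with lowerᴸ , lower ← dist-lower L (suc i) r j avail =
  (λ L≡true → ≤-trans (lowerᴸ L≡true) (≤-reflexive (cong suc (sym (+-suc i (toℕ j)))))) ,
  λ { zero occ → contradiction refl occ ; (suc m) occ → lower m occ }
dist-lower L i (just _ ∷ r) (suc j) avail with lowerᴸ , lower ← dist-lower true 0 r j avail =
  (λ _ → ≤-trans (lowerᴸ refl) (s≤s (≤-trans (n≤1+n _) (m≤n+m (suc (toℕ j)) i)))) ,
  λ { zero _ → lowerᴸ refl ; (suc m) occ → lower m occ }

-- The last hypothesis excludes the junk distance of a gap bounded on neither side.
dist-attained : ∀ {n} L i (r : Row n) j → Available r j → L ≡ true ⊎ ∃ (Occupied r) →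
  (L ≡ true × dist L i r j ≡ suc (i + toℕ j)) ⊎
  (∃[ m ] Occupied r m × dist L i r j ≡ ∣ toℕ m - toℕ j ∣)
dist-attained L i (nothing ∷ r) zero _ nearby with gaps r | firstOccupied r
dist-attained true i (nothing ∷ r) zero _ _ | _ | none _ = inj₁ (refl , cong suc (sym (+-identityʳ i)))
dist-attained false i (nothing ∷ r) zero _ (inj₂ (zero , occ)) | _ | none _ = contradiction refl occ
dist-attained false i (nothing ∷ r) zero _ (inj₂ (suc m , occ)) | _ | none avail = contradiction (avail m) occ
dist-attained true i (nothing ∷ r) zero _ _ | _ | at j occ _ with ⊓-sel i (toℕ j)
... | inj₁ ≡i = inj₁ (refl , cong suc (trans ≡i (sym (+-identityʳ i))))
... | inj₂ ≡j = inj₂ (suc j , occ , cong suc ≡j)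
dist-attained false i (nothing ∷ r) zero _ _ | _ | at j occ _ = inj₂ (suc j , occ , refl)
dist-attained L i (nothing ∷ r) (suc j) avail nearby
  with dist-attained L (suc i) r j avail (nearby′ nearby)
  where
  nearby′ : L ≡ true ⊎ ∃ (Occupied (nothing ∷ r)) → L ≡ true ⊎ ∃ (Occupied r)
  nearby′ (inj₁ L≡true)        = inj₁ L≡true
  nearby′ (inj₂ (zero , occ))  = contradiction refl occ
  nearby′ (inj₂ (suc m , occ)) = inj₂ (m , occ)
... | inj₁ (L≡true , d≡)  = inj₁ (L≡true , trans d≡ (cong suc (sym (+-suc i (toℕ j)))))
... | inj₂ (m , occ , d≡) = inj₂ (suc m , occ , d≡)
dist-attained L i (just _ ∷ r) (suc j) avail _ with dist-attained true 0 r j avail (inj₁ refl)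
... | inj₁ (_ , d≡)       = inj₂ (zero , (λ ()) , d≡)
... | inj₂ (m , occ , d≡) = inj₂ (suc m , occ , d≡)

module _ {n} (r : Row n) (someone : ∃ (Occupied r)) where

  private
    d : Fin n → ℕ
    d = dist false 0 r

  dist-witness : ∀ j → Available r j → ∃[ m ] Occupied r m × d j ≡ ∣ toℕ m - toℕ j ∣
  dist-witness j avail with dist-attained false 0 r j avail (inj₂ someone)
  ... | inj₂ witness = witness

  dist>0 : ∀ j → Available r j → 0 < d j
  dist>0 j avail with m , occ , d≡ ← dist-witness j avail = n≢0⇒n>0 λ d≡0 →
    occ (subst (Available r) (sym (Fin.toℕ-injective (∣m-n∣≡0⇒m≡n (trans (sym d≡) d≡0)))) avail)

  distanceToOccupied≡dist : ∀ j → Available r j → distanceToOccupied r j ≡ d j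
  distanceToOccupied≡dist j avail with m , occ , d≡ ← dist-witness j avail =
    min≈v⁺
      (subst (_∈ map (λ i → ∣ toℕ i - toℕ j ∣) (occupied r)) (sym d≡)
        (∈-map⁺ _ (∈-filter⁺ (λ i → ¬? (available? r i)) (∈-allFin m) occ)))
      (All.map⁺ (All.map (λ {i} → proj₂ (dist-lower false 0 r j avail) i)
                         (All.all-filter (λ i → ¬? (available? r i)) (allFin n))))
      -- The default n of `min` is at least every distance in the row.
      (subst (_≤ n) (sym d≡)
        (≤-trans (∣m-n∣≤m⊔n (toℕ m) (toℕ j)) (⊔-lub (<⇒≤ (Fin.toℕ<n m)) (<⇒≤ (Fin.toℕ<n j)))))

-- Counting completions

vacancies : ∀ {n} → Row n → ℕ
vacancies []            = 0
vacancies (nothing ∷ r) = suc (vacancies r)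
vacancies (just _ ∷ r)  = vacancies r

vacancies-≔ : ∀ {n} p (r : Row n) j → Available r j → vacancies r ≡ suc (vacancies (r [ j ]≔ just p))
vacancies-≔ p (nothing ∷ r) zero    _     = refl
vacancies-≔ p (nothing ∷ r) (suc j) avail = cong suc (vacancies-≔ p r j avail)
vacancies-≔ p (just _ ∷ r)  (suc j) avail = vacancies-≔ p r j avail

vacancies-replicate : ∀ n → vacancies (replicate n nothing) ≡ n
vacancies-replicate zero    = refl
vacancies-replicate (suc n) = cong suc (vacancies-replicate n)

available-exists : ∀ {n s} (r : Row n) → vacancies r ≡ suc s → ∃ (Available r)
available-exists (nothing ∷ r) _  = zero , refl
available-exists (just _ ∷ r)  v≡ with j , avail ← available-exists r v≡ = suc j , avail

value-zero : ∀ L R → value L R 0 ≡ []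
value-zero true  true  = refl
value-zero true  false = refl
value-zero false true  = refl
value-zero false false = refl

multiset-full : ∀ {n} L (r : Row n) → vacancies r ≡ 0 → multiset L (gaps r) ≡ []
multiset-full L []           _  = value-zero L false
multiset-full L (just _ ∷ r) v≡0 = cong₂ _++_ (value-zero L true) (multiset-full true r v≡0)

rowMultiset : ∀ {n} → Row n → Multiset
rowMultiset r = multiset false (gaps r)

-- Identifies `⌈ b /2⌉` as the level of b, to be used for the greatest element.
half-up : ∀ b → b ≡ 2 * ⌈ b /2⌉ ⊎ b ≡ 2 * ⌈ b /2⌉ ∸ 1
half-up zero          = inj₁ refl
half-up (suc zero)    = inj₂ refl
half-up (suc (suc b)) with half-up b
... | inj₁ b≡ = inj₁ (trans (cong (2 +_) b≡) (sym (2*suc ⌈ b /2⌉)))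
... | inj₂ b≡ with ⌈ b /2⌉
...   | zero  = inj₁ (cong (2 +_) b≡)
...   | suc q = inj₂ (trans (cong (2 +_) (trans b≡ (2*suc∸1 q)))
                            (sym (trans (2*suc∸1 (suc q)) (cong (1 +_) (2*suc q)))))

b≤2*⌈b/2⌉ : ∀ b → b ≤ 2 * ⌈ b /2⌉
b≤2*⌈b/2⌉ b with half-up b
... | inj₁ b≡ = ≤-reflexive b≡
... | inj₂ b≡ = ≤-trans (≤-reflexive b≡) (m∸n≤m _ 1)

#>0 : ∀ {x y M} → x ∈ M → x ≡ y → 0 < #[ y ] M
#>0 {x} x∈M refl = filter-some (x ≟_) x∈M

-- A positive maximum is not the default 0, so it is an element of `M` at that level.
level-max>0 : ∀ M → 0 < max 0 M → 0 < level ⌈ max 0 M /2⌉ M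
level-max>0 M max>0 with argmax-sel id 0 M
... | inj₁ max≡0 = contradiction max≡0 (>⇒≢ max>0)
... | inj₂ max∈M with half-up (max 0 M)
...   | inj₁ max≡ = ≤-trans (#>0 max∈M max≡) (m≤m+n _ _)
...   | inj₂ max≡ = ≤-trans (#>0 max∈M max≡) (m≤n+m _ _)

sum>0 : ∀ {n} (f : Fin n → ℕ) → 0 < sum (tabulate f) → ∃[ j ] 0 < f j
sum>0 {suc n} f Σ>0 with f zero in f₀
... | suc w = zero , subst (0 <_) (sym f₀) z<s
... | zero with j , fj>0 ← sum>0 (f ∘ suc) Σ>0 = suc j , fj>0

sum-filter : ∀ {A : Set} {P : A → Set} (P? : Decidable P) (f g : A → ℕ) →
  (∀ x → P x → f x ≡ g x) → (∀ x → ¬ P x → g x ≡ 0) →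
  ∀ xs → sum (map f (filter P? xs)) ≡ sum (map g xs)
sum-filter P? f g f≡g g≡0 []       = refl
sum-filter P? f g f≡g g≡0 (x ∷ xs) with P? x
... | yes px = cong₂ _+_ (f≡g x px) (sum-filter P? f g f≡g g≡0 xs)
... | no ¬px = cong₂ _+_ (sym (g≡0 x ¬px)) (sum-filter P? f g f≡g g≡0 xs)

sum-allFin : ∀ n (f : Fin n → ℕ) → sum (map f (allFin n)) ≡ sum (tabulate f)
sum-allFin n f = cong sum (map-tabulate id f)

weightAt-≡ : ∀ {n} p {k} (r : Row n) j → Available r j → dist false 0 r j ≡ k →
  weightAt p k false 0 [] r j ≡ G (rowMultiset (r [ j ]≔ just p))
weightAt-≡ p r j avail d≡k rewrite avail =
  trans (hit-≡ _ d≡k) (cong (λ γ → G (multiset false γ)) (⊕-identityˡ (gaps (r [ j ]≔ just p))))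

weightAt-≢ : ∀ {n} p {k} (r : Row n) j → (Available r j → dist false 0 r j ≢ k) →
  weightAt p k false 0 [] r j ≡ 0
weightAt-≢ p r j d≢k with lookup r j
... | just _  = refl
... | nothing = hit-≢ _ (d≢k refl)

weightAt>0 : ∀ {n} p {k} (r : Row n) j → 0 < weightAt p k false 0 [] r j →
  Available r j × dist false 0 r j ≡ k
weightAt>0 p {k} r j w>0 =
  decidable-stable (available? r j) (λ occ → ≢0 λ avail → contradiction avail occ) ,
  decidable-stable (dist false 0 r j ≟ k) (λ d≢k → ≢0 λ _ → d≢k)
  where
  ≢0 : ¬ (Available r j → dist false 0 r j ≢ k)
  ≢0 d≢k = >⇒≢ w>0 (weightAt-≢ p r j d≢k)

module _ {n} (r : Row n) (someone : ∃ (Occupied r)) (free : ∃ (Available r)) (p : ℕ) where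

  private
    M : Multiset
    M = rowMultiset r

    k : ℕ
    k = ⌈ max 0 M /2⌉

    d : Fin n → ℕ
    d = dist false 0 r

    w : Fin n → ℕ
    w = weightAt p k false 0 [] r

    M≤2k : All (_≤ 2 * k) M
    M≤2k = All.map (λ x≤b → ≤-trans x≤b (b≤2*⌈b/2⌉ (max 0 M))) (xs≤max 0 M)

    d≤k : ∀ j → Available r j → d j ≤ k
    d≤k j = dist-≤ false 0 r j (subst (λ γ → All (_≤ 2 * k) (multiset false γ)) (sym (⊕-identityˡ (gaps r))) M≤2k)

    k>0 : 0 < k
    k>0 = ≤-trans (dist>0 r someone (proj₁ free) (proj₂ free)) (d≤k (proj₁ free) (proj₂ free))

    level>0 : 0 < level k M
    level>0 = level-max>0 M (n≢0⇒n>0 λ max≡0 → >⇒≢ k>0 (cong ⌈_/2⌉ max≡0))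

    level*hits : ∀ k → 0 < k → All (_≤ 2 * k) M → level k M * hits k false 0 [] (gaps r) ≡ level k M * G M
    level*hits (suc q) _ = hits-total q false [] (gaps r)

    Σw≡G : sum (tabulate w) ≡ G M
    Σw≡G = trans (sum-weightAt p k false 0 [] r)
      (*-cancelˡ-≡ _ _ (level k M) {{>-nonZero level>0}} (level*hits k k>0 M≤2k))

    -- The weights sum to `G M`, which is positive, so one of them is: the bound k on the distances
    -- is attained.
    furthest : ∃[ j ] Available r j × d j ≡ k
    furthest with j , w>0 ← sum>0 w (subst (0 <_) (sym Σw≡G) (>-nonZero⁻¹ (G M) {{G≢0 M}})) =
      j , weightAt>0 p r j w>0

    obeysP1⇒dist≡k : ∀ {j} → ObeysP1 r j → d j ≡ k
    obeysP1⇒dist≡k {j} (avail , maximal) = ≤-antisym (d≤k j avail)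
      (subst₂ _≤_ (trans (distanceToOccupied≡dist r someone m availₘ) (proj₂ (proj₂ furthest)))
                  (distanceToOccupied≡dist r someone j avail) (maximal m availₘ))
      where
      m = proj₁ furthest
      availₘ = proj₁ (proj₂ furthest)

    dist≡k⇒obeysP1 : ∀ {j} → Available r j → d j ≡ k → ObeysP1 r j
    dist≡k⇒obeysP1 {j} avail d≡k = avail , λ m availₘ →
      subst₂ _≤_ (sym (distanceToOccupied≡dist r someone m availₘ))
                 (sym (trans (distanceToOccupied≡dist r someone j avail) d≡k)) (d≤k m availₘ)

  sum-obeysP1 : (f : Fin n → ℕ) → (∀ j → Available r j → f j ≡ G (rowMultiset (r [ j ]≔ just p))) →
    sum (map f (filter (obeysP1? r) (allFin n))) ≡ G M
  sum-obeysP1 f f≡G = begin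
    sum (map f (filter (obeysP1? r) (allFin n)))
      ≡⟨ sum-filter (obeysP1? r) f w
           (λ j obeys → trans (f≡G j (proj₁ obeys))
                              (sym (weightAt-≡ p r j (proj₁ obeys) (obeysP1⇒dist≡k obeys))))
           (λ j ¬obeys → weightAt-≢ p r j λ avail d≡k → ¬obeys (dist≡k⇒obeysP1 avail d≡k))
           (allFin n) ⟩
    sum (map w (allFin n))
      ≡⟨ sum-allFin n w ⟩
    sum (tabulate w)
      ≡⟨ Σw≡G ⟩
    G M ∎

-- Counts the sequences of choices of persons t + 1, ..., t + s.
completions : ∀ {n} → ℕ → Row n → ℕ → ℕ
completions     zero    r t = 1
completions {n} (suc s) r t =
  sum (map (λ j → completions s (r [ j ]≔ just (suc t)) (suc t)) (filter (obeysP1? r) (allFin n)))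

≔-occupied : ∀ {n} p (r : Row n) j → Occupied (r [ j ]≔ just p) j
≔-occupied p r j avail with () ← trans (sym (lookup∘update j r (just p))) avail

completions≡G : ∀ {n} s (r : Row n) t → ∃ (Occupied r) → vacancies r ≡ s → completions s r t ≡ G (rowMultiset r)
completions≡G zero    r t _       v≡ = sym (cong G (multiset-full false r v≡))
completions≡G (suc s) r t someone v≡ =
  sum-obeysP1 r someone (available-exists r v≡) (suc t) _ λ j avail →
    completions≡G s _ (suc t) (j , ≔-occupied (suc t) r j)
      (suc-injective (trans (sym (vacancies-≔ (suc t) r j avail)) v≡))

sum-concatMap : ∀ {A B : Set} (g : B → ℕ) (f : A → List B) xs →
  sum (map g (concatMap f xs)) ≡ sum (map (λ x → sum (map g (f x))) xs)
sum-concatMap g f []       = refl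
sum-concatMap g f (x ∷ xs) = begin
  sum (map g (f x ++ concatMap f xs))                 ≡⟨ cong sum (map-++ g (f x) (concatMap f xs)) ⟩
  sum (map g (f x) ++ map g (concatMap f xs))         ≡⟨ sum-++ (map g (f x)) _ ⟩
  sum (map g (f x)) + sum (map g (concatMap f xs))    ≡⟨ cong (sum (map g (f x)) +_) (sum-concatMap g f xs) ⟩
  sum (map g (f x)) + sum (map (λ x → sum (map g (f x))) xs) ∎

length≡sum : ∀ {A : Set} (xs : List A) → length xs ≡ sum (map (λ _ → 1) xs)
length≡sum []       = refl
length≡sum (x ∷ xs) = cong suc (length≡sum xs)

-- Induction on s hands persons over from `completions` to `rowsAfter`, one at a time.
length-rowsAfter : ∀ n s t →
  length (rowsAfter n (suc (s + t))) ≡ sum (map (λ r → completions s r (suc t)) (rowsAfter n (suc t)))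
length-rowsAfter n zero    t = length≡sum (rowsAfter n (suc t))
length-rowsAfter n (suc s) t = begin
  length (rowsAfter n (suc (suc s + t)))
    ≡⟨ cong (λ u → length (rowsAfter n (suc u))) (+-suc s t) ⟨
  length (rowsAfter n (suc (s + suc t)))
    ≡⟨ length-rowsAfter n s (suc t) ⟩
  sum (map (λ r → completions s r (suc (suc t))) (rowsAfter n (suc (suc t))))
    ≡⟨ sum-concatMap _ _ (rowsAfter n (suc t)) ⟩
  sum (map (λ r → sum (map (λ r → completions s r (suc (suc t))) (next r))) (rowsAfter n (suc t)))
    ≡⟨ cong sum (map-cong (λ r → cong sum (sym (map-∘ (filter (obeysP1? r) (allFin n))))) (rowsAfter n (suc t))) ⟩
  sum (map (λ r → completions (suc s) r (suc t)) (rowsAfter n (suc t))) ∎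
  where
  next = λ r → map (λ j → r [ j ]≔ just (suc (suc t))) (filter (obeysP1? r) (allFin n))

-- Different choices lead to different rows

deduplicate-unique : ∀ {A : Set} (_≟_ : DecidableEquality A) {xs} → Unique xs → deduplicate _≟_ xs ≡ xs
deduplicate-unique _≟_ []                      = refl
deduplicate-unique _≟_ {x ∷ xs} (x≢ ∷ unique) = cong (x ∷_)
  (trans (cong (filter (λ y → ¬? (x ≟ y))) (deduplicate-unique _≟_ unique))
         (filter-all (λ y → ¬? (x ≟ y)) x≢))

Bounded : ∀ {n} → ℕ → Row n → Set
Bounded t r = ∀ j p → lookup r j ≡ just p → p ≤ t

bounded-replicate : ∀ {n} → Bounded 0 (replicate n nothing)
bounded-replicate j p ≡p with () ← trans (sym (lookup-replicate j nothing)) ≡p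

bounded-≔ : ∀ {n t} (r : Row n) → Bounded t r → ∀ j → Bounded (suc t) (r [ j ]≔ just (suc t))
bounded-≔ {t = t} r bounded j m p ≡p with m Fin.≟ j
... | yes refl = ≤-reflexive (just-injective (trans (sym ≡p) (lookup∘update j r (just (suc t)))))
... | no  m≢j  = m≤n⇒m≤1+n (bounded m p (trans (sym (lookup∘update′ m≢j r _)) ≡p))

-- The label t + 1 does not yet occur in `r′`, so after the update it marks the chosen payphone.
same-position : ∀ {n t} (r r′ : Row n) → Bounded t r′ → ∀ {j j′} →
  r [ j ]≔ just (suc t) ≡ r′ [ j′ ]≔ just (suc t) → j ≡ j′
same-position {t = t} r r′ bounded {j} {j′} r≡ with j Fin.≟ j′
... | yes j≡j′ = j≡j′
... | no  j≢j′ = contradiction (bounded j (suc t) (begin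
  lookup r′ j                            ≡⟨ lookup∘update′ j≢j′ r′ _ ⟨
  lookup (r′ [ j′ ]≔ just (suc t)) j     ≡⟨ cong (λ r → lookup r j) r≡ ⟨
  lookup (r [ j ]≔ just (suc t)) j       ≡⟨ lookup∘update j r _ ⟩
  just (suc t)                           ∎)) 1+n≰n

undo-≔ : ∀ {n} p (r : Row n) j → Available r j → (r [ j ]≔ just p) [ j ]≔ nothing ≡ r
undo-≔ p r j avail = begin
  (r [ j ]≔ just p) [ j ]≔ nothing ≡⟨ []≔-idempotent r j ⟩
  r [ j ]≔ nothing                 ≡⟨ cong (r [ j ]≔_) avail ⟨
  r [ j ]≔ lookup r j              ≡⟨ []≔-lookup r j ⟩
  r                                ∎

rowsAfter-bounded : ∀ n t → All (Bounded (suc t)) (rowsAfter n (suc t))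
rowsAfter-bounded n zero    = All.map⁺ (All.universal (bounded-≔ (replicate n nothing) bounded-replicate) (allFin n))
rowsAfter-bounded n (suc t) = All.concat⁺ (All.map⁺ (All.map
  (λ {r} bounded → All.map⁺ (All.universal (bounded-≔ r bounded) _)) (rowsAfter-bounded n t)))

-- The greatest label shows the last choice, and erasing it recovers the previous row; so every row
-- arises in one way only.
rowsAfter-unique : ∀ n t → Unique (rowsAfter n (suc t))
rowsAfter-unique n zero    = Unique.map⁺ (same-position _ _ bounded-replicate) (Unique.allFin⁺ n)
rowsAfter-unique n (suc t) = Unique.concat⁺
  (All.map⁺ (All.map (λ {r} bounded → Unique.map⁺ (same-position r r bounded)
                                        (Unique.filter⁺ (obeysP1? r) (Unique.allFin⁺ n)))
                     (rowsAfter-bounded n t)))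
  (AllPairs.map⁺ (disjoint (rowsAfter-bounded n t) (rowsAfter-unique n t)))
  where
  T = suc (suc t)
  next : Row n → List (Row n)
  next r = map (λ j → r [ j ]≔ just T) (filter (obeysP1? r) (allFin n))
  next-disjoint : ∀ {r r′} → Bounded (suc t) r′ → r ≢ r′ → Disjoint (next r) (next r′)
  next-disjoint {r} {r′} bounded r≢r′ (v∈ , v∈′)
    with j , _ , v≡ , obeys ← ∈-map∘filter⁻ (λ j → r [ j ]≔ just T) (obeysP1? r) {xs = allFin n} v∈
       | j′ , _ , v≡′ , obeys′ ← ∈-map∘filter⁻ (λ j → r′ [ j ]≔ just T) (obeysP1? r′) {xs = allFin n} v∈′
    with refl ← same-position r r′ bounded (trans (sym v≡) v≡′)
    = r≢r′ (begin
      r                               ≡⟨ undo-≔ T r j (proj₁ obeys) ⟨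
      (r [ j ]≔ just T) [ j ]≔ nothing  ≡⟨ cong (_[ j ]≔ nothing) (trans (sym v≡) v≡′) ⟩
      (r′ [ j ]≔ just T) [ j ]≔ nothing ≡⟨ undo-≔ T r′ j (proj₁ obeys′) ⟩
      r′                              ∎)
  disjoint : ∀ {rs} → All (Bounded (suc t)) rs → Unique rs → AllPairs (Disjoint on next) rs
  disjoint []       []       = []
  disjoint (_ ∷ bs) (u ∷ us) =
    All.zipWith (λ (bounded , r≢r′) {v} → next-disjoint bounded r≢r′ {v}) (bs , u) ∷ disjoint bs us

-- The choice of the first person

gaps-replicate : ∀ n → gaps (replicate n nothing) ≡ last n
gaps-replicate zero    = refl
gaps-replicate (suc n) = cong (1 ⊕_) (gaps-replicate n)

gaps-single : ∀ n p (j : Fin n) →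
  gaps (replicate n nothing [ j ]≔ just p) ≡ toℕ j ▷ last (n ∸ suc (toℕ j))
gaps-single (suc n) p zero    = cong (0 ▷_) (gaps-replicate n)
gaps-single (suc n) p (suc j) = cong (1 ⊕_) (gaps-single n p j)

sum-tabulate-toℕ : ∀ (f : ℕ → ℕ) n → sum (tabulate {n = n} (f ∘ toℕ)) ≡ sum (applyUpTo f n)
sum-tabulate-toℕ f zero    = refl
sum-tabulate-toℕ f (suc n) = cong (f 0 +_) (sum-tabulate-toℕ (f ∘ suc) n)

theorem5 : ∀ (n : ℕ) → 1 ≤ n →
    P₁ n ≡ sum (map (λ i → G (S′ (i ∸ 1) ++ S′ (n ∸ i))) [ 1 ⋯ n ])
theorem5 n@(suc m) _ = begin
  P₁ n
    ≡⟨ cong length (deduplicate-unique _ (rowsAfter-unique n m)) ⟩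
  length (rowsAfter n (suc m))
    ≡⟨ cong (λ s → length (rowsAfter n (suc s))) (+-identityʳ m) ⟨
  length (rowsAfter n (suc (m + 0)))
    -- The first choice is free and is summed over; m = n - 1 persons remain.
    ≡⟨ length-rowsAfter n m 0 ⟩
  sum (map (λ r → completions m r 1) (rowsAfter n 1))
    ≡⟨ cong sum (map-∘ (allFin n)) ⟨
  sum (map (λ j → completions m (first j) 1) (allFin n))
    ≡⟨ sum-allFin n _ ⟩
  sum (tabulate {n = n} (λ j → completions m (first j) 1))
    ≡⟨ cong sum (tabulate-cong λ j → completions≡G m (first j) 1 (j , ≔-occupied 1 empty j) (vacancies-first j)) ⟩
  sum (tabulate {n = n} (λ j → G (rowMultiset (first j))))
    -- The first person leaves two gaps at the ends of the row, of lengths j and n - 1 - j with j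
    -- counted from 0.
    ≡⟨ cong sum (tabulate-cong λ j → cong (λ γ → G (multiset false γ)) (gaps-single n 1 j)) ⟩
  sum (tabulate {n = n} (λ j → G (S′ (toℕ j) ++ S′ (n ∸ suc (toℕ j)))))
    ≡⟨ sum-tabulate-toℕ (λ i → G (S′ i ++ S′ (n ∸ suc i))) n ⟩
  sum (applyUpTo (λ i → G (S′ i ++ S′ (n ∸ suc i))) n)
    ≡⟨ cong sum (map-⋯ (λ i → G (S′ (i ∸ 1) ++ S′ (n ∸ i))) 1 n) ⟨
  sum (map (λ i → G (S′ (i ∸ 1) ++ S′ (n ∸ i))) [ 1 ⋯ n ]) ∎
  where
  empty = replicate n nothing
  first = λ j → empty [ j ]≔ just 1
  vacancies-first : ∀ j → vacancies (first j) ≡ m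
  vacancies-first j = suc-injective
    (trans (sym (vacancies-≔ 1 empty j (lookup-replicate j nothing))) (vacancies-replicate n))
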